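{- Let $m,n\ge 1$ be integers. The sequence $d_1d_2\ldots d_{m^n}$ representing the game tree for the warden's game with $n$ $m$-sided dice is the lexicographically minimal $m$-ary de Bruijn sequence of rank $n$. That is, it is an $m$-ary de Bruijn sequence of rank $n$, and among all $m$-ary de Bruijn sequences of rank $n$ (written as words of length $m^n$) it is the lexicographically smallest.
   Context: De Bruijn sequences: given positive integers $m$ and $n$, an $m$-ary de Bruijn sequence of rank $n$ is a sequence of $m^n$ numbers from $\{0,\ldots,m-1\}$ such that each possible string of $n$ numbers from $\{0,\ldots,m-1\}$ appears exactly once in the sequence treated as a loop (i.e. as a block of $n$ cyclically consecutive terms, indices taken modulo $m^n$). The warden's game with $n$ $m$-sided dice: a position is a string $x_1x_2\ldots x_n$ with each $x_i\in\{0,1,\ldots,m-1\}$. There are two players, the prisoner and the warden, both with full information. In each move the rightmost die is transferred to the far left, possibly with a changed value, so that $x_1\ldots x_n$ becomes $c\,x_1\ldots x_{n-1}$ for some $c$ determined as follows. The warden first chooses either (i) to transfer the die himself, strictly decreasing its value, i.e. he chooses any $c$ with $0\le c<x_n$ (impossible if $x_n=0$), or (ii) to pass, in which case the prisoner must transfer the die and chooses any $c$ with $x_n\le c\le m-1$. The prisoner wins when the goal position, consisting of all $(m-1)$'s, is reached. Remoteness: $r(\beta)$ is the least $k\ge 1$ such that the prisoner has a strategy guaranteeing that, starting from position $\beta$, the goal position is reached after some number $t$ of moves with $1\le t\le k$ (so the goal position, treated as a starting position, has positive remoteness). It is known that for each $j\in\{1,\ldots,m^n\}$ there is exactly one position $p_j$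 with $r(p_j)=j$, and that $p_{m^n}$ is the goal position; put $p_0=p_{m^n}$. Since the optimal move from $p_{j}$ is to $p_{j-1}$, the last $n-1$ digits of $p_{j-1}$ are the first $n-1$ digits of $p_j$ for $1\le j\le m^n$. The sequence representing the game tree is $d_1d_2\ldots d_{m^n}$, where $d_j$ is the last digit of $p_j$. (For example, for $m=n=3$ it is $000100201101202102211121222$, and for $m=2$, $n=4$ it is $0000100110101111$.) -}

module Defs where

open import Data.Fin using (Fin; toℕ; fromℕ; _≤_; _<_)
open import Data.List using (List; applyDownFrom)
import Data.Nat as ℕ
open import Data.Nat using (ℕ; suc; NonZero; _+_; _^_)
open import Data.Nat.DivMod using (_mod_)
open import Data.Nat.Properties using (m^n≢0)
open import Data.Product using (Σ-syntax; ∃-syntax; ∃!; _×_; proj₁)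
open import Data.Vec using (Vec; _∷_; init; last; lookup; replicate; tabulate)
open import Data.Vec.Relation.Binary.Lex.Strict using (Lex-≤)
open import Relation.Binary.PropositionalEquality using (_≡_)

module _ {m n : ℕ} .{{_ : NonZero m}} where

  cyclicBlock : Vec (Fin m) (m ^ n) → Fin (m ^ n) → Vec (Fin m) n
  cyclicBlock s i =
    tabulate λ (k : Fin n) → lookup s (_mod_ (toℕ i + toℕ k) (m ^ n) {{m^n≢0 m n}})

  IsDeBruijn : Vec (Fin m) (m ^ n) → Set
  IsDeBruijn s = ∀ (w : Vec (Fin m) n) → ∃! _≡_ λ i → cyclicBlock s i ≡ w

  IsLexMinimalDeBruijn : Vec (Fin m) (m ^ n) → Set
  IsLexMinimalDeBruijn s =
    IsDeBruijn s × (∀ s′ → IsDeBruijn s′ → Lex-≤ _≡_ _<_ s s′)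

-- m = suc m′ and n = suc n′ are positive, so the largest digit m - 1 is
-- fromℕ m′ and every position has a rightmost die.
module WardenGame (m′ n′ : ℕ) where

  m n : ℕ
  m = suc m′
  n = suc n′

  Position : Set
  Position = Vec (Fin m) n

  goal : Position
  goal = replicate n (fromℕ m′)

  transfer : Fin m → Position → Position
  transfer c β = c ∷ init β

  -- What the prisoner can do once the warden has passed.
  Response : Position → Set
  Response β = Σ[ c ∈ Fin m ] last β ≤ c

  -- The response may depend on all earlier positions (most recent first) as
  -- well as on the current one.
  Strategy : Set
  Strategy = List Position → (β : Position) → Response β

  data Move (β : Position) (response : Response β) : Position → Set where
    wardenLowers : ∀ c → c < last β → Move β response (transfer c β)
    wardenPasses : Move β response (transfer (proj₁ response) β)

  -- A play is continued for ever, also after visits to the goal; only the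
  -- time of reaching the goal matters below.
  IsPlay : Strategy → (ℕ → Position) → Set
  IsPlay σ play =
    ∀ t → Move (play t) (σ (applyDownFrom play t) (play t)) (play (suc t))

  GuaranteesGoalWithin : Strategy → ℕ → Position → Set
  GuaranteesGoalWithin σ k β =
    ∀ play → play 0 ≡ β → IsPlay σ play →
    ∃[ t ] 1 ℕ.≤ t × t ℕ.≤ k × play t ≡ goal

  CanForceGoalWithin : ℕ → Position → Set
  CanForceGoalWithin k β = ∃[ σ ] GuaranteesGoalWithin σ k β

  IsRemoteness : Position → ℕ → Set
  IsRemoteness β k =
    1 ℕ.≤ k × CanForceGoalWithin k β ×
    (∀ k′ → 1 ℕ.≤ k′ → CanForceGoalWithin k′ β → k ℕ.≤ k′)

  -- Fin (m ^ n) counts from 0: p i is the position of remoteness toℕ i + 1.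
  EnumeratesByRemoteness : (Fin (m ^ n) → Position) → Set
  EnumeratesByRemoteness p = ∀ i → IsRemoteness (p i) (suc (toℕ i))

  gameTreeSequence : (Fin (m ^ n) → Position) → Vec (Fin m) (m ^ n)
  gameTreeSequence p = tabulate λ i → last (p i)

{-# OPTIONS --safe #-}

-- A position u b is won within k + 1 moves iff c u is the goal or won within k
-- moves for every c < b and for some c ≥ b.  Hence consecutive positions in order
-- of remoteness overlap, so they are the windows of d, and d is greedy: when b
-- follows u, all u b′ with b′ < b are windows already, where the goal M^n
-- (M = m - 1) precedes d.  So if a de Bruijn sequence d′ first departs from d by a
-- smaller digit b′ following u, then u b′ must be one of the initial windows
-- M^(n-j) 0^j with 1 ≤ j < n, which straddle the start of d.  But by then d has
-- passed through 0^j M^(n-j), and hence through all c M^(n-1-l) 0^l with c < M and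
-- j ≤ l < n.  Going backwards from its initial block 0^n, d′ is thus forced to end
-- in M^(n-j), so M^(n-j) 0^j occurs cyclically at the start of d′ as well as in u b′.
module Submission where

open import Defs
open import Algebra.Properties.CommutativeSemigroup using (xy∙z≈xz∙y)
open import Data.Fin as Fin using (Fin; zero; suc; fromℕ; toℕ; funToFin; finToFun; punchOut)
import Data.Fin.Properties as Fin
open import Data.List as List using (List; []; _∷_; applyDownFrom)
open import Data.Nat using
  (ℕ; zero; suc; pred; _+_; _*_; _^_; _∸_; _≤_; _<_; _≤?_; _<?_; NonZero; z≤n; s≤s; z<s; s≤s⁻¹)
open import Data.Nat.DivMod using
  (_%_; _mod_; m%n<n; m<n⇒m%n≡m; m%n%n≡m%n; n%n≡0; [m+n]%n≡m%n; [m+kn]%n≡m%n; %-distribˡ-+)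
open import Data.Nat.Induction using (<-rec)
open import Data.Nat.Properties
open import Data.Product using (∃-syntax; _×_; _,_; proj₁; proj₂)
open import Data.Sum using (_⊎_; inj₁; inj₂)
open import Data.Unit using (tt)
open import Data.Vec using (Vec; []; _∷_; _∷ʳ_; init; last; head; lookup; replicate)
open import Data.Vec.Properties using
  (≡-dec; init-∷ʳ; last-∷ʳ; lookup∘tabulate; tabulate∘lookup; tabulate-cong)
open import Data.Vec.Relation.Binary.Lex.Core using (base; this; next)
open import Data.Vec.Relation.Binary.Lex.Strict using (Lex-≤)
open import Function using (const; _∘_)
open import Function.Definitions using (Injective)
open import Relation.Binary.Definitions using (tri<; tri≈; tri>)
open import Relation.Binary.PropositionalEquality
open import Relation.Nullary using (¬_; Dec; yes; no; contradiction)
open import Relation.Nullary.Decidable using (¬?; _⊎-dec_; decidable-stable)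

-- Digits of vectors, the lexicographic order, and counting in finite sets.

module _ {A : Set} where

  -- Indices beyond the end give the last entry.
  digit : ∀ {n} → Vec A (suc n) → ℕ → A
  digit (x ∷ xs)     zero    = x
  digit (x ∷ [])     (suc k) = x
  digit (x ∷ y ∷ ys) (suc k) = digit (y ∷ ys) k

  digit-last : ∀ {n} (xs : Vec A (suc n)) → digit xs n ≡ last xs
  digit-last (x ∷ [])     = refl
  digit-last (x ∷ y ∷ ys) = digit-last (y ∷ ys)

  digit-init : ∀ {n} c (xs : Vec A (suc n)) {k} → k < n → digit (c ∷ init xs) (suc k) ≡ digit xs k
  digit-init c (x ∷ y ∷ ys) {zero}  _         = refl
  digit-init c (x ∷ y ∷ ys) {suc k} (s≤s k<n) = digit-init x (y ∷ ys) k<n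

  digit-∷ʳ : ∀ {n} (xs : Vec A (suc n)) b {k} → k < n → digit (init xs ∷ʳ b) k ≡ digit xs k
  digit-∷ʳ xs b {k} k<n = begin
    digit (init xs ∷ʳ b) k                     ≡⟨ sym (digit-init b (init xs ∷ʳ b) k<n) ⟩
    digit (b ∷ init (init xs ∷ʳ b)) (suc k)    ≡⟨ cong (λ ys → digit (b ∷ ys) (suc k))
                                                    (init-∷ʳ b (init xs)) ⟩
    digit (b ∷ init xs) (suc k)                ≡⟨ digit-init b xs k<n ⟩
    digit xs k                                 ∎
    where open ≡-Reasoning

  digit-replicate : ∀ n (x : A) k → digit (replicate (suc n) x) k ≡ x
  digit-replicate n       x zero    = refl
  digit-replicate zero    x (suc k) = refl
  digit-replicate (suc n) x (suc k) = digit-replicate n x k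

  lookup-digit : ∀ {n} (xs : Vec A (suc n)) k → lookup xs k ≡ digit xs (toℕ k)
  lookup-digit (x ∷ xs)     zero    = refl
  lookup-digit (x ∷ y ∷ ys) (suc k) = lookup-digit (y ∷ ys) k

  lookup-ext : ∀ {n} {xs ys : Vec A n} → lookup xs ≗ lookup ys → xs ≡ ys
  lookup-ext {xs = xs} {ys} same =
    trans (sym (tabulate∘lookup xs)) (trans (tabulate-cong same) (tabulate∘lookup ys))

-- In this form only the first difference has to be examined, and agreement before it may be
-- assumed.
≤-lexicographic : ∀ {m n} (xs ys : Vec (Fin m) n) →
  (∀ i → (∀ j → j Fin.< i → lookup xs j ≡ lookup ys j) → ¬ (lookup ys i Fin.< lookup xs i)) →
  Lex-≤ _≡_ Fin._<_ xs ys
≤-lexicographic []       []       _ = base tt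
≤-lexicographic (x ∷ xs) (y ∷ ys) notSmaller with Fin.<-cmp x y
... | tri< x<y _ _  = this x<y refl
... | tri> _ _ y<x  = contradiction y<x (notSmaller zero λ _ ())
... | tri≈ _ refl _ = next refl (≤-lexicographic xs ys λ i same →
  notSmaller (suc i) λ { zero _ → refl ; (suc j) (s≤s j<i) → same j j<i })

injective⇒surjective : ∀ {n} {f : Fin n → Fin n} → Injective _≡_ _≡_ f → ∀ y → ∃[ x ] f x ≡ y
injective⇒surjective {suc n} {f} injective y with Fin.any? (λ x → f x Fin.≟ y)
... | yes found = found
-- Deleting the missed value would embed `Fin (suc n)` into `Fin n`.
... | no  missed = contradiction
  (Fin.injective⇒≤ {f = λ x → punchOut (y≢f x)}
    (injective ∘ Fin.punchOut-injective (y≢f _) (y≢f _)))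
  1+n≰n
  where
  y≢f : ∀ x → y ≢ f x
  y≢f x y≡fx = missed (x , sym y≡fx)

-- Residues modulo `N`.

module _ (N : ℕ) .{{_ : NonZero N}} where

  %-remainderˡ : ∀ x y → (x % N + y) % N ≡ (x + y) % N
  %-remainderˡ x y = begin
    (x % N + y) % N              ≡⟨ %-distribˡ-+ (x % N) y N ⟩
    (x % N % N + y % N) % N      ≡⟨ cong (λ z → (z + y % N) % N) (m%n%n≡m%n x N) ⟩
    (x % N + y % N) % N          ≡⟨ sym (%-distribˡ-+ x y N) ⟩
    (x + y) % N                  ∎
    where open ≡-Reasoning

  -- Adding `c * pred N` plays the part of subtracting `c` modulo `N`.
  %-complement : ∀ x c → (x + c + c * pred N) % N ≡ x % N
  %-complement x c = begin
    (x + c + c * pred N) % N    ≡⟨ cong (_% N) (+-assoc x c (c * pred N)) ⟩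
    (x + (c + c * pred N)) % N  ≡⟨ cong (λ z → (x + z) % N) (sym (*-suc c (pred N))) ⟩
    (x + c * suc (pred N)) % N  ≡⟨ cong (λ z → (x + c * z) % N) (suc-pred N) ⟩
    (x + c * N) % N             ≡⟨ [m+kn]%n≡m%n x c N ⟩
    x % N                       ∎
    where open ≡-Reasoning

  %-cancelʳ-+ : ∀ c {x y} → (x + c) % N ≡ (y + c) % N → x % N ≡ y % N
  %-cancelʳ-+ c {x} {y} eq = begin
    x % N                             ≡⟨ sym (%-complement x c) ⟩
    (x + c + c * pred N) % N          ≡⟨ sym (%-remainderˡ (x + c) _) ⟩
    ((x + c) % N + c * pred N) % N    ≡⟨ cong (λ z → (z + c * pred N) % N) eq ⟩
    ((y + c) % N + c * pred N) % N    ≡⟨ %-remainderˡ (y + c) _ ⟩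
    (y + c + c * pred N) % N          ≡⟨ %-complement y c ⟩
    y % N                             ∎
    where open ≡-Reasoning

  toℕ-mod : ∀ x → toℕ (x mod N) ≡ x % N
  toℕ-mod x = Fin.toℕ-fromℕ< (m%n<n x N)

  mod-cong : ∀ {x y} → x % N ≡ y % N → x mod N ≡ y mod N
  mod-cong {x} {y} eq = Fin.toℕ-injective (trans (toℕ-mod x) (trans eq (sym (toℕ-mod y))))

  mod-injective : ∀ {x y} → x mod N ≡ y mod N → x % N ≡ y % N
  mod-injective {x} {y} eq = trans (sym (toℕ-mod x)) (trans (cong toℕ eq) (toℕ-mod y))

  toℕ[i]mod≡i : ∀ (i : Fin N) → toℕ i mod N ≡ i
  toℕ[i]mod≡i i = Fin.toℕ-injective (trans (toℕ-mod (toℕ i)) (m<n⇒m%n≡m (Fin.toℕ<n i)))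

  %-distinct : ∀ {t t′} → 1 ≤ t → t < t′ → t′ ≤ N → t % N ≢ t′ % N
  %-distinct {t} {t′} 1≤t t<t′ t′≤N eq with m≤n⇒m<n∨m≡n t′≤N
  ... | inj₁ t′<N = <⇒≢ t<t′ (trans (sym (m<n⇒m%n≡m (<-trans t<t′ t′<N))) (trans eq (m<n⇒m%n≡m t′<N)))
  ... | inj₂ refl = <⇒≢ 1≤t (sym (trans (sym (m<n⇒m%n≡m t<t′)) (trans eq (n%n≡0 N))))

-- Histories of plays.

module _ {A : Set} where

  -- Histories list the most recent position first, so forgetting the start of a play removes the
  -- end of the list.
  dropOldest : List A → List A
  dropOldest []           = []
  dropOldest (x ∷ [])     = []
  dropOldest (x ∷ y ∷ ys) = x ∷ dropOldest (y ∷ ys)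

  oldest : A → List A → A
  oldest x []       = x
  oldest x (y ∷ ys) = oldest y ys

  dropOldest-applyDownFrom : ∀ (f : ℕ → A) t →
    dropOldest (applyDownFrom f (suc t)) ≡ applyDownFrom (f ∘ suc) t
  dropOldest-applyDownFrom f zero    = refl
  dropOldest-applyDownFrom f (suc t) = cong (f (suc t) ∷_) (dropOldest-applyDownFrom f t)

  oldest-applyDownFrom : ∀ (f : ℕ → A) t → oldest (f t) (applyDownFrom f t) ≡ f 0
  oldest-applyDownFrom f zero    = refl
  oldest-applyDownFrom f (suc t) = oldest-applyDownFrom f t

  infixr 5 _◂_
  _◂_ : A → (ℕ → A) → ℕ → A
  (x ◂ f) zero    = x
  (x ◂ f) (suc t) = f t

  applyDownFrom-◂ : ∀ x (f : ℕ → A) t →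
    applyDownFrom (x ◂ f) (suc t) ≡ applyDownFrom f t List.++ x ∷ []
  applyDownFrom-◂ x f zero    = refl
  applyDownFrom-◂ x f (suc t) = cong (f t ∷_) (applyDownFrom-◂ x f t)

-- The recursion for winning within a given number of moves.

module WardenGameProperties (m′ n′ : ℕ) where
  open WardenGame m′ n′

  infix 4 _≟ₚ_
  _≟ₚ_ : (β γ : Position) → Dec (β ≡ γ)
  _≟ₚ_ = ≡-dec Fin._≟_

  -- Forcing demands a visit to the goal at a time of at least 1, so after a move the case of being
  -- there already must be added.
  AtGoalOrForces : ℕ → Position → Set
  AtGoalOrForces k β = β ≡ goal ⊎ CanForceGoalWithin k β

  ReachesGoalWithin : Strategy → ℕ → Position → Set
  ReachesGoalWithin σ k β =
    ∀ play → play 0 ≡ β → IsPlay σ play → ∃[ t ] t ≤ k × play t ≡ goal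

  anyStrategy : Strategy
  anyStrategy _ β = last β , ≤-refl

  atGoalOrForces⇒reaches : ∀ {k β} → AtGoalOrForces k β → ∃[ σ ] ReachesGoalWithin σ k β
  atGoalOrForces⇒reaches (inj₁ β≡goal) =
    anyStrategy , λ play start _ → 0 , z≤n , trans start β≡goal
  atGoalOrForces⇒reaches (inj₂ (σ , guarantees)) =
    σ , λ play start isPlay → let t , _ , t≤k , hit = guarantees play start isPlay in t , t≤k , hit

  Favourable : ℕ → Position → Set
  Favourable k β =
    (∃[ c ] last β Fin.≤ c × AtGoalOrForces k (transfer c β)) ×
    (∀ c → c Fin.< last β → AtGoalOrForces k (transfer c β))

  -- The new strategy answers as if the play had begun one move earlier, at `β`. In that longer play
  -- a hit at time 1 would be `γ` itself, so the hit comes later and can be shifted back.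
  afterMove : ∀ {σ k β γ} → GuaranteesGoalWithin σ (suc k) β → Move β (σ [] β) γ →
              AtGoalOrForces k γ
  afterMove {σ} {k} {β} {γ} guarantees move with γ ≟ₚ goal
  ... | yes γ≡goal = inj₁ γ≡goal
  ... | no  γ≢goal = inj₂ (σ′ , guarantees′)
    where
    σ′ : Strategy
    σ′ history = σ (history List.++ β ∷ [])

    guarantees′ : GuaranteesGoalWithin σ′ k γ
    guarantees′ play start isPlay with guarantees (β ◂ play) refl isPlay′
      where
      isPlay′ : IsPlay σ (β ◂ play)
      isPlay′ zero    = subst (Move β (σ [] β)) (sym start) move
      isPlay′ (suc t) = subst (λ h → Move (play t) (σ h (play t)) (play (suc t)))
                          (sym (applyDownFrom-◂ β play t)) (isPlay t)
    ... | suc zero    , _ , _         , hit = contradiction (trans (sym start) hit) γ≢goal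
    ... | suc (suc t) , _ , s≤s t<k+1 , hit = suc t , s≤s z≤n , t<k+1 , hit

  force⇒favourable : ∀ {k β} → CanForceGoalWithin (suc k) β → Favourable k β
  force⇒favourable {k} {β} (σ , guarantees) =
    (proj₁ (σ [] β) , proj₂ (σ [] β) , afterMove {σ} guarantees wardenPasses) ,
    λ c c<last → afterMove {σ} guarantees (wardenLowers c c<last)

  -- One strategy must serve every first move: it hands the play over to a strategy for the
  -- successor reached, with `β` removed from the history.
  favourable⇒force : ∀ {k β} → Favourable k β → CanForceGoalWithin (suc k) β
  favourable⇒force {k} {β} ((c₀ , last≤c₀ , good₀) , good) = σ , guarantees
    where
    Possible : Fin m → Set
    Possible c = c Fin.< last β ⊎ c ≡ c₀

    possible? : ∀ c → Dec (Possible c)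
    possible? c = (c Fin.<? last β) ⊎-dec (c Fin.≟ c₀)

    possible⇒good : ∀ {c} → Possible c → AtGoalOrForces k (transfer c β)
    possible⇒good (inj₁ c<last) = good _ c<last
    possible⇒good (inj₂ refl)   = good₀

    continuation : Fin m → Strategy
    continuation c with possible? c
    ... | yes possible = proj₁ (atGoalOrForces⇒reaches (possible⇒good possible))
    ... | no  _        = anyStrategy

    continuation-reaches : ∀ {c} → Possible c →
                           ReachesGoalWithin (continuation c) k (transfer c β)
    continuation-reaches {c} possible with possible? c
    ... | yes possible′ = proj₂ (atGoalOrForces⇒reaches (possible⇒good possible′))
    ... | no  impossible = contradiction possible impossible

    -- A strategy must answer everywhere, while `c₀` is legal only if the last digit is at most
    -- `c₀`; otherwise the reply is arbitrary.
    firstResponse : ∀ γ → Response γ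
    firstResponse γ with last γ Fin.≤? c₀
    ... | yes last≤ = c₀ , last≤
    ... | no  _     = last γ , ≤-refl

    firstResponse-β : proj₁ (firstResponse β) ≡ c₀
    firstResponse-β with last β Fin.≤? c₀
    ... | yes _    = refl
    ... | no last≰ = contradiction last≤c₀ last≰

    -- The second position of the play tells which move was made first.
    σ : Strategy
    σ []              γ = firstResponse γ
    σ history@(_ ∷ _) γ =
      let recent = dropOldest history in continuation (head (oldest γ recent)) recent γ

    firstMove : ∀ {γ} → Move β (firstResponse β) γ → ∃[ c ] Possible c × γ ≡ transfer c β
    firstMove (wardenLowers c c<last) = c , inj₁ c<last , refl
    firstMove wardenPasses            = _ , inj₂ firstResponse-β , refl

    guarantees : GuaranteesGoalWithin σ (suc k) β
    guarantees play start isPlay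
      with firstMove (subst (λ γ → Move γ (firstResponse γ) (play 1)) start (isPlay 0))
    ... | c , possible , play₁ with continuation-reaches possible (play ∘ suc) play₁ isPlay′
      where
      isPlay′ : IsPlay (continuation c) (play ∘ suc)
      -- At `t = 0` the shortened history is empty, and `oldest` falls back on the current position
      -- `play 1`.
      isPlay′ t = subst₂
        (λ h γ → Move (play (suc t)) (continuation (head γ) h (play (suc t))) (play (suc (suc t))))
        (dropOldest-applyDownFrom play t)
        (trans (cong (oldest (play (suc t))) (dropOldest-applyDownFrom play t))
          (trans (oldest-applyDownFrom (play ∘ suc) t) play₁))
        (isPlay (suc t))
    ... | t , t≤k , hit = suc t , s≤s z≤n , s≤s t≤k , hit

  force-mono : ∀ {k k′ β} → k ≤ k′ → CanForceGoalWithin k β → CanForceGoalWithin k′ β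
  force-mono k≤k′ (σ , guarantees) = σ , λ play start isPlay →
    let t , 1≤t , t≤k , hit = guarantees play start isPlay in t , 1≤t , ≤-trans t≤k k≤k′ , hit

  -- A guarantee speaks only about plays, so a play is needed to refute it: the one in which the
  -- warden always passes, built together with its history.
  ¬forceWithin0 : ∀ {β} → ¬ CanForceGoalWithin 0 β
  ¬forceWithin0 {β} (σ , guarantees) =
    let _ , 1≤t , t≤0 , _ = guarantees play refl isPlay in contradiction (≤-trans 1≤t t≤0) λ ()
    where
    run : ℕ → Position × List Position
    run zero    = β , []
    run (suc t) = let γ , history = run t in transfer (proj₁ (σ history γ)) γ , γ ∷ history

    play : ℕ → Position
    play = proj₁ ∘ run

    history≡ : ∀ t → proj₂ (run t) ≡ applyDownFrom play t
    history≡ zero    = refl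
    history≡ (suc t) = cong (play t ∷_) (history≡ t)

    isPlay : IsPlay σ play
    isPlay t = subst (λ h → Move (play t) (σ h (play t)) (play (suc t))) (history≡ t) wardenPasses

  favourable-map : ∀ {k k′ β} →
    (∀ c → AtGoalOrForces k (transfer c β) → AtGoalOrForces k′ (transfer c β)) →
    Favourable k β → Favourable k′ β
  favourable-map f ((c , last≤c , good) , lower) =
    (c , last≤c , f c good) , λ c c<last → f c (lower c c<last)

-- Words as functions, and the combinatorics of the greedy sequence.

module _ {A : Set} where

  prepend : ℕ → A → (ℕ → A) → ℕ → A
  prepend zero    x f k       = f k
  prepend (suc r) x f zero    = x
  prepend (suc r) x f (suc k) = prepend r x f k

  prepend-< : ∀ {r x f k} → k < r → prepend r x f k ≡ x
  prepend-< {suc r} {k = zero}  _         = refl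
  prepend-< {suc r} {k = suc k} (s≤s k<r) = prepend-< {r} k<r

  prepend-+ : ∀ r {x f} k → prepend r x f (r + k) ≡ f k
  prepend-+ zero    k = refl
  prepend-+ (suc r) k = prepend-+ r k

  prepend-+′ : ∀ r {x f} k → prepend r x f (k + r) ≡ f k
  prepend-+′ r {x} {f} k = trans (cong (prepend r x f) (+-comm k r)) (prepend-+ r k)

  prepend-≥ : ∀ {r x y k} → r ≤ k → prepend r x (const y) k ≡ y
  prepend-≥ {r} {x} {y} {k} r≤k =
    trans (cong (prepend r x (const y)) (sym (m+[n∸m]≡n r≤k))) (prepend-+ r (k ∸ r))

-- The positions in order of remoteness are the windows a t … a (t + n′), with
-- the goal at t = 0.  The hypothesis greedy says that the prisoner does no worse
-- from a position whose last digit is lowered, and maximal that a position ending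
-- in m - 1 lets the warden choose any c < m - 1 and the prisoner only c = m - 1.
module MaxFirst
  (m′ n′ N : ℕ) (a : ℕ → Fin (suc m′))
  (start : ∀ {k} → k ≤ n′ → a k ≡ fromℕ m′)
  (greedy : ∀ {t b} → t < N → b Fin.< a (suc t + n′) →
    ∃[ t′ ] 1 ≤ t′ × t′ ≤ t ×
      (∀ {k} → k < n′ → a (t′ + k) ≡ a (suc t + k)) × a (t′ + n′) ≡ b)
  (maximal : ∀ {t} c → t < N → a (suc t + n′) ≡ fromℕ m′ →
    ∃[ t′ ] t′ ≤ t × a t′ ≡ c ×
      (∀ {k} → k < n′ → a (t′ + suc k) ≡ a (suc t + k)))
  (max≢0 : fromℕ m′ ≢ zero)
  where

  private
    M = fromℕ m′

  OccursAt : (ℕ → Fin (suc m′)) → ℕ → Set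
  OccursAt f t = ∀ {k} → k ≤ n′ → a (t + k) ≡ f k

  -- If b = a (suc x + n′) were nonzero, greedy would put the word maxs-then-zeros
  -- ending in 0 at an earlier window, which still has a maximal digit too far right.
  zeros : ∀ x → x ≤ n′ → x < N → a (suc x + n′) ≡ zero
  zeros = <-rec _ step
    where
    step : ∀ x → (∀ {y} → y < x → y ≤ n′ → y < N → a (suc y + n′) ≡ zero) →
           x ≤ n′ → x < N → a (suc x + n′) ≡ zero
    step x ih x≤n′ x<N with a (suc x + n′) in eq
    ... | zero = refl
    ... | suc b with greedy {b = zero} x<N (subst (λ d → 0 < Fin.toℕ d) (sym eq) z<s)
    ... | suc t , _ , t<x , same , _ = contradiction (trans (sym isM) is0) max≢0
      where
      -- The index, within the window at `suc t`, of the last initial maximal digit `a n′`.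
      k : ℕ
      k = n′ ∸ suc t
      t<n′ : suc t ≤ n′
      t<n′ = ≤-trans t<x x≤n′
      k<n′ : k < n′
      k<n′ = ∸-monoʳ-< {n′} {suc t} {0} z<s t<n′
      isM : a (suc t + k) ≡ M
      isM = trans (cong a (m+[n∸m]≡n t<n′)) (start ≤-refl)
      y : ℕ
      y = x ∸ suc t
      y<x : y < x
      y<x = ∸-monoʳ-< {x} {suc t} {0} z<s t<x
      arith : suc x + k ≡ suc y + n′
      arith = cong suc (begin
        x + k                 ≡⟨ cong (_+ k) (sym (m∸n+n≡m t<x)) ⟩
        (y + suc t) + k       ≡⟨ +-assoc y (suc t) k ⟩
        y + (suc t + k)       ≡⟨ cong (y +_) (m+[n∸m]≡n t<n′) ⟩
        y + n′                ∎)
        where open ≡-Reasoning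
      is0 : a (suc t + k) ≡ zero
      is0 = trans (same k<n′) (trans (cong a arith)
              (ih y<x (≤-trans (<⇒≤ y<x) x≤n′) (<-trans y<x x<N)))

  -- The side condition on f excludes the all-maximal word, which occurs at 0.
  rotate : ∀ r {k f g} → k ≤ N → OccursAt f k →
    (∀ {i} → i ≤ n′ → n′ < i + r → f i ≡ M) →
    (∃[ i ] i + r ≤ n′ × f i ≢ M) →
    (∀ {i} → i + r ≤ n′ → g (i + r) ≡ f i) →
    ∃[ k′ ] k′ + r ≤ k × OccursAt g k′
  rotate zero {k} {f} {g} k≤N occ _ _ gf =
    k , ≤-reflexive (+-identityʳ k) ,
    λ {i} i≤n′ → trans (occ i≤n′) (trans (sym (gf (subst (_≤ n′) (sym (+-identityʳ i)) i≤n′)))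
                                          (cong g (+-identityʳ i)))
  rotate (suc r) {zero} k≤N occ _ (i , i+r≤n′ , fi≢M) gf =
    contradiction (trans (sym (occ i≤n′)) (start i≤n′)) fi≢M
    where i≤n′ = m+n≤o⇒m≤o i i+r≤n′
  -- One use of `maximal` trades the final maximal digit for the leading digit `g r`, at a strictly
  -- earlier window; the other `r` digits follow by induction.
  rotate (suc r) {suc t} {f} {g} k≤N occ end (i , i+r≤n′ , fi≢M) gf
    with maximal {t} (g r) k≤N (trans (occ ≤-refl) (end ≤-refl (m<m+n n′ z<s)))
  ... | t₁ , t₁≤t , head≡ , tail≡ = extend
    (rotate r {t₁} {f₁} {g} (≤-trans t₁≤t (<⇒≤ k≤N)) occ₁ end₁
      (suc i , subst (_≤ n′) (+-suc i r) i+r≤n′ , fi≢M) gf₁)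
    where
    f₁ : ℕ → Fin (suc m′)
    f₁ zero    = g r
    f₁ (suc j) = f j
    occ₁ : OccursAt f₁ t₁
    occ₁ {zero}  _    = trans (cong a (+-identityʳ t₁)) head≡
    occ₁ {suc j} j<n′ = trans (tail≡ j<n′) (occ (<⇒≤ j<n′))
    end₁ : ∀ {j} → j ≤ n′ → n′ < j + r → f₁ j ≡ M
    end₁ {zero} _ n′<r =
      contradiction (≤-trans (n≤1+n r) (≤-trans (m≤n+m (suc r) i) i+r≤n′)) (<⇒≱ n′<r)
    end₁ {suc j} j<n′ lt = end (<⇒≤ j<n′) (subst (n′ <_) (sym (+-suc j r)) lt)
    gf₁ : ∀ {j} → j + r ≤ n′ → g (j + r) ≡ f₁ j
    gf₁ {zero}  _ = refl
    gf₁ {suc j} le = trans (cong g (sym (+-suc j r))) (gf (subst (_≤ n′) (sym (+-suc j r)) le))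
    extend : ∃[ k′ ] k′ + r ≤ t₁ × OccursAt g k′ → ∃[ k′ ] k′ + suc r ≤ suc t × OccursAt g k′
    extend (k′ , k′+r≤t₁ , occ′) =
      k′ , subst (_≤ suc t) (sym (+-suc k′ r)) (s≤s (≤-trans k′+r≤t₁ t₁≤t)) , occ′

  EndsMaximal : ℕ → ℕ → Set
  EndsMaximal j k = ∀ {i} → j ≤ i → i ≤ n′ → a (k + i) ≡ M

  ZeroMaxBlock : ℕ → ℕ → Set
  ZeroMaxBlock j k = (∀ {i} → i < j → a (k + i) ≡ zero) × EndsMaximal j k

  -- The block 0^j M^(n-j) comes no later than other windows ending in M^(n-j), where n - j =
  -- `suc r`.

  module _ {j r : ℕ} (1≤j : 1 ≤ j) (j+r≡n′ : j + r ≡ n′) where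

    private
      1+r = suc r

      j≤n′ : j ≤ n′
      j≤n′ = m+n≤o⇒m≤o j (≤-reflexive j+r≡n′)

      room : ∀ {i} → i < j → i + 1+r ≤ n′
      room {i} i<j = subst₂ _≤_ (sym (+-suc i r)) j+r≡n′ (+-monoˡ-≤ r i<j)

      room′ : ∀ {i} → i < j → i + r ≤ n′
      room′ {i} i<j = ≤-trans (+-monoʳ-≤ i (n≤1+n r)) (room i<j)

      r≤n′ : r ≤ n′
      r≤n′ = m+n≤o⇒n≤o j (≤-reflexive j+r≡n′)

      BlockBefore : ℕ → Set
      BlockBefore k = ∃[ k₀ ] k₀ ≤ k × ZeroMaxBlock j k₀

      weaken : ∀ {q k} → q ≤ k → BlockBefore q → BlockBefore k
      weaken q≤k (k₀ , k₀≤q , block) = k₀ , ≤-trans k₀≤q q≤k , block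

      Earlier : ℕ → Set
      Earlier k = ∀ {q} → q < k → 1 ≤ q → q ≤ N → EndsMaximal j q → BlockBefore q

      -- The word M^n is outside the scope of `rotate`. As `1 ≤ j`, the window one place back still
      -- ends in M^(n-j); it is not the one at 0, since a zero follows that.
      allMaximal : ∀ k → Earlier k → 1 ≤ k → k ≤ N →
                   (∀ {i} → i ≤ n′ → a (k + i) ≡ M) → BlockBefore k
      allMaximal (suc zero) _ _ k≤N isGoal =
        contradiction (trans (sym (isGoal ≤-refl)) (zeros 0 z≤n k≤N)) max≢0
      allMaximal (suc (suc q)) ih _ k≤N isGoal =
        weaken (n≤1+n _) (ih ≤-refl (s≤s z≤n) (<⇒≤ k≤N) end)
        where
        end : EndsMaximal j (suc q)
        end {zero}  j≤0 _    = contradiction (≤-trans 1≤j j≤0) λ ()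
        end {suc i} _   i<n′ = trans (cong (a ∘ suc) (+-suc q i)) (isGoal (<⇒≤ i<n′))

      module Step (k : ℕ) (ih : Earlier k)
        (1≤k : 1 ≤ k) (k≤N : k ≤ N) (end : EndsMaximal j k) where

        -- Going back `j` places moves the leading M^(n-j) to the end of a window; `j < k′` keeps
        -- its index positive.
        fromEarlier : ∀ {k′} → k′ ≤ k → j < k′ → (∀ {i} → i < 1+r → a (k′ + i) ≡ M) →
                      BlockBefore k
        fromEarlier {k′} k′≤k j<k′ beginsM =
          weaken (<⇒≤ q<k) (ih q<k (m<n⇒0<n∸m j<k′) (≤-trans (<⇒≤ q<k) k≤N) end′)
          where
          q = k′ ∸ j
          q<k : q < k
          q<k = <-≤-trans (∸-monoʳ-< {k′} {j} {0} 1≤j (<⇒≤ j<k′)) k′≤k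
          end′ : EndsMaximal j q
          end′ {i} j≤i i≤n′ = trans (cong a arith) (beginsM i∸j<1+r)
            where
            arith : q + i ≡ k′ + (i ∸ j)
            arith = begin
              q + i               ≡⟨ cong (q +_) (sym (m+[n∸m]≡n j≤i)) ⟩
              q + (j + (i ∸ j))   ≡⟨ sym (+-assoc q j (i ∸ j)) ⟩
              q + j + (i ∸ j)     ≡⟨ cong (_+ (i ∸ j)) (m∸n+n≡m (<⇒≤ j<k′)) ⟩
              k′ + (i ∸ j)        ∎
              where open ≡-Reasoning
            i∸j<1+r : i ∸ j < 1+r
            i∸j<1+r = s≤s (subst (i ∸ j ≤_) (m+n∸m≡n j r)
                             (∸-monoˡ-≤ j (≤-trans i≤n′ (≤-reflexive (sym j+r≡n′)))))

        notAllMaximal : ∀ {i₀} → i₀ < j → a (k + i₀) ≢ M → BlockBefore k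
        notAllMaximal {i₀} i₀<j notM
          with rotate 1+r {k} {λ i → a (k + i)} {prepend 1+r M (λ i → a (k + i))}
                 k≤N (λ _ → refl)
                 (λ {i} i≤n′ lt → end (≮⇒≥ λ i<j → <⇒≱ lt (room i<j)) i≤n′)
                 (i₀ , room i₀<j , notM)
                 (λ {i} _ → prepend-+′ 1+r i)
        ... | k′ , k′+r≤k , occ with <-cmp k′ j
        ... | tri> _ _ j<k′ =
          fromEarlier (m+n≤o⇒m≤o k′ k′+r≤k) j<k′
            (λ {i} i<1+r → trans (occ (≤-trans (s≤s⁻¹ i<1+r) r≤n′))
                             (prepend-< {r = 1+r} i<1+r))
        -- The window at `j` is M^(n-j) 0^j, so the window at `k` is itself the block.
        ... | tri≈ _ refl _ = k , ≤-refl , zero-part , end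
          where
          zero-part : ∀ {i} → i < j → a (k + i) ≡ zero
          zero-part {i} i<j = begin
            a (k + i)                                  ≡⟨ sym (prepend-+′ 1+r i) ⟩
            prepend 1+r M (λ i → a (k + i)) (i + 1+r)  ≡⟨ sym (occ (room i<j)) ⟩
            a (j + (i + 1+r))                          ≡⟨ cong a arith ⟩
            a (suc i + n′)                             ≡⟨ zeros i (≤-trans (<⇒≤ i<j) j≤n′)
                                                            (<-≤-trans i<j (≤-trans (m+n≤o⇒m≤o j k′+r≤k) k≤N)) ⟩
            zero                                       ∎
            where
            open ≡-Reasoning
            arith : j + (i + 1+r) ≡ suc i + n′
            arith = begin
              j + (i + suc r)   ≡⟨ cong (j +_) (+-suc i r) ⟩
              j + (suc i + r)   ≡⟨ sym (+-assoc j (suc i) r) ⟩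
              j + suc i + r     ≡⟨ cong (_+ r) (+-comm j (suc i)) ⟩
              suc i + j + r     ≡⟨ +-assoc (suc i) j r ⟩
              suc i + (j + r)   ≡⟨ cong (suc i +_) j+r≡n′ ⟩
              suc i + n′        ∎
        -- Let z be the first `j` digits at `k`. The window at `k′` starts with more than `1+r`
        -- maximal digits, so z begins with M. Rotating only `r` digits gives M^r z M, which again
        -- begins with M^(1+r).
        ... | tri< k′<j _ _
          with rotate r {k} {λ i → a (k + i)} {prepend r M (λ i → a (k + i))}
                 k≤N (λ _ → refl)
                 (λ {i} i≤n′ lt → end (≮⇒≥ λ i<j → <⇒≱ lt (room′ i<j)) i≤n′)
                 (i₀ , room′ i₀<j , notM)
                 (λ {i} _ → prepend-+′ r i)
        ...   | k″ , k″+r≤k , occ″ = byPosition k″ k″+r≤k occ″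
          where
          F = λ i → a (k + i)
          headM : a (k + 0) ≡ M
          headM = trans (sym (prepend-+′ 1+r 0)) (trans (sym (occ (room 1≤j))) (start (room k′<j)))
          byPosition : ∀ k″ → k″ + r ≤ k → OccursAt (prepend r M F) k″ → BlockBefore k
          byPosition k″ k″+r≤k occ″ with j <? k″
          ... | yes j<k″ = fromEarlier (m+n≤o⇒m≤o k″ k″+r≤k) j<k″ beginsM
            where
            beginsM : ∀ {i} → i < 1+r → a (k″ + i) ≡ M
            beginsM {i} (s≤s i≤r) with m≤n⇒m<n∨m≡n i≤r
            ... | inj₁ i<r  = trans (occ″ (≤-trans i≤r r≤n′)) (prepend-< {r = r} i<r)
            ... | inj₂ refl = trans (occ″ r≤n′)
                                (trans (prepend-+′ r 0) headM)
          -- At 0 all digits are maximal, but z contains the digit at `i₀`.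
          byPosition zero k″+r≤k occ″ | no _ = contradiction Fi₀≡M notM
            where
            i₀+r≤n′ = room′ i₀<j
            Fi₀≡M : F i₀ ≡ M
            Fi₀≡M = trans (sym (prepend-+′ r i₀)) (trans (sym (occ″ i₀+r≤n′)) (start i₀+r≤n′))
          -- The windows at 1 to `j` end in 0, but M^r z M ends in M.
          byPosition (suc x) k″+r≤k occ″ | no j≮k″ =
            contradiction (trans (sym lastM) last0) max≢0
            where
            x<j = ≮⇒≥ j≮k″
            last0 : a (suc x + n′) ≡ zero
            last0 = zeros x (≤-trans (<⇒≤ x<j) j≤n′) (≤-trans (m+n≤o⇒m≤o (suc x) k″+r≤k) k≤N)
            lastM : a (suc x + n′) ≡ M
            lastM = trans (occ″ ≤-refl) (trans (cong (prepend r M F) (sym j+r≡n′))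
                      (trans (prepend-+′ r j) (end ≤-refl j≤n′)))

        blockBefore : BlockBefore k
        blockBefore with anyUpTo? (λ i → ¬? (a (k + i) Fin.≟ M)) j
        ... | yes (i₀ , i₀<j , notM) = notAllMaximal i₀<j notM
        ... | no none = allMaximal k ih 1≤k k≤N isGoal
          where
          isGoal : ∀ {i} → i ≤ n′ → a (k + i) ≡ M
          isGoal {i} i≤n′ with i <? j
          ... | yes i<j = decidable-stable (a (k + i) Fin.≟ M) λ ≢M → none (i , i<j , ≢M)
          ... | no  i≮j = end (≮⇒≥ i≮j) i≤n′

    -- Rotating the trailing maximal digits of the window z M^r to the front gives
    -- the earlier window M^r z.  Going back j steps from it yields an earlier window
    -- ending in M^r, unless M^r z is one of the initial windows M^(n-t) 0^t.
    zeroMaxBlockFirst : ∀ k → 1 ≤ k → k ≤ N → EndsMaximal j k →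
                        ∃[ k₀ ] k₀ ≤ k × ZeroMaxBlock j k₀
    zeroMaxBlockFirst =
      <-rec (λ k → 1 ≤ k → k ≤ N → EndsMaximal j k → BlockBefore k) Step.blockBefore

  -- Comparison with a sequence `b` that departs from `a` by a smaller digit.

  module _
    (b : ℕ → Fin (suc m′)) {i : ℕ} (i<N : i < N)
    (agree : ∀ {y} → n′ < y → y < suc i + n′ → b y ≡ a y)
    (distinct : ∀ {t t′} → 1 ≤ t → t < t′ → t′ ≤ N →
      ¬ (∀ {k} → k ≤ n′ → b (t + k) ≡ b (t′ + k)))
    where

    private
      module Smaller (smaller : b (suc i + n′) Fin.< a (suc i + n′)) where

        -- The digits of `a` that follow the initial M^n begin with zeros, which nothing undercuts.
        n′<i : n′ < i
        n′<i = ≰⇒> λ i≤n′ →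
          contradiction
            (subst (λ d → Fin.toℕ (b (suc i + n′)) < Fin.toℕ d) (zeros i i≤n′ i<N) smaller) λ ()

        beforeI : ∀ {t k} → t ≤ i → k ≤ n′ → t + k < suc i + n′
        beforeI t≤i k≤n′ = s≤s (+-mono-≤ t≤i k≤n′)

        -- The place where `a` already has the word that `b` has at `suc i`.
        j : ℕ
        j = proj₁ (greedy i<N smaller)
        1≤j : 1 ≤ j
        1≤j = proj₁ (proj₂ (greedy i<N smaller))
        j≤i : j ≤ i
        j≤i = proj₁ (proj₂ (proj₂ (greedy i<N smaller)))
        sameInit : ∀ {k} → k < n′ → a (j + k) ≡ a (suc i + k)
        sameInit = proj₁ (proj₂ (proj₂ (proj₂ (greedy i<N smaller))))

        same : ∀ {k} → k ≤ n′ → a (j + k) ≡ b (suc i + k)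
        same {k} k≤n′ with m≤n⇒m<n∨m≡n k≤n′
        ... | inj₁ k<n′ = trans (sameInit k<n′)
          (sym (agree (≤-trans n′<i (≤-trans (n≤1+n i) (m≤m+n (suc i) k))) (+-monoʳ-< (suc i) k<n′)))
        ... | inj₂ refl = proj₂ (proj₂ (proj₂ (proj₂ (greedy i<N smaller))))

        -- Beyond `n′` the window at `j` is shared by `b`, which would then repeat it at `suc i`.
        j≤n′ : j ≤ n′
        j≤n′ = ≮⇒≥ λ n′<j → distinct 1≤j (s≤s j≤i) i<N λ {k} k≤n′ →
          trans (agree (≤-trans n′<j (m≤m+n j k)) (beforeI j≤i k≤n′)) (same k≤n′)

        r : ℕ
        r = n′ ∸ j
        j+r≡n′ : j + r ≡ n′
        j+r≡n′ = m+[n∸m]≡n j≤n′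

        room : ∀ {k} → k < j → k + suc r ≤ n′
        room {k} k<j = subst₂ _≤_ (sym (+-suc k r)) j+r≡n′ (+-monoˡ-≤ r k<j)

        -- Going back `j` places from `suc i` moves the leading M^(n-j) of that window to the end.
        K : ℕ
        K = suc i ∸ j
        K≤i : K ≤ i
        K≤i = ∸-monoʳ-≤ (suc i) 1≤j

        endK : EndsMaximal j K
        endK {k} j≤k k≤n′ = begin
          a (K + k)              ≡⟨ cong a arith ⟩
          a (suc i + (k ∸ j))    ≡⟨ sym (sameInit k∸j<n′) ⟩
          a (j + (k ∸ j))        ≡⟨ cong a (m+[n∸m]≡n j≤k) ⟩
          a k                    ≡⟨ start k≤n′ ⟩
          M                      ∎
          where
          open ≡-Reasoning
          k∸j<n′ : k ∸ j < n′
          k∸j<n′ = <-≤-trans (∸-monoʳ-< {k} {j} {0} 1≤j j≤k) k≤n′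
          arith : K + k ≡ suc i + (k ∸ j)
          arith = begin
            K + k               ≡⟨ cong (K +_) (sym (m+[n∸m]≡n j≤k)) ⟩
            K + (j + (k ∸ j))   ≡⟨ sym (+-assoc K j (k ∸ j)) ⟩
            K + j + (k ∸ j)     ≡⟨ cong (_+ (k ∸ j)) (m∸n+n≡m (≤-trans j≤i (n≤1+n i))) ⟩
            suc i + (k ∸ j)     ∎

        block : ∃[ k₀ ] k₀ ≤ K × ZeroMaxBlock j k₀
        block = zeroMaxBlockFirst 1≤j j+r≡n′ K (m<n⇒0<n∸m (s≤s j≤i)) (≤-trans K≤i (<⇒≤ i<N)) endK

        -- The word c M^e 0^l, where e + l = n′.
        headWord : Fin (suc m′) → ℕ → ℕ → Fin (suc m′)
        headWord c e zero    = c
        headWord c e (suc k) = prepend e M (const zero) k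

        -- Rotating M^(n-j) off the end of 0^j M^(n-j) permits any n - j digits in front of 0^j, in
        -- particular c M^e 0^(r-e).
        headWordEarly : ∀ c {e} → e ≤ r → ∃[ t ] t ≤ i × OccursAt (headWord c e) t
        headWordEarly c {e} e≤r = early block
          where
          early : ∃[ k₀ ] k₀ ≤ K × ZeroMaxBlock j k₀ → ∃[ t ] t ≤ i × OccursAt (headWord c e) t
          early (k₀ , k₀≤K , isZero , isM)
            with rotate (suc r) {k₀} {λ k → a (k₀ + k)} {headWord c e}
                   (≤-trans k₀≤K (≤-trans K≤i (<⇒≤ i<N))) (λ _ → refl)
                   (λ {k} k≤n′ lt → isM (≮⇒≥ λ k<j → <⇒≱ lt (room k<j)) k≤n′)
                   (0 , room 1≤j , λ is-M → max≢0 (trans (sym is-M) (isZero 1≤j)))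
                   (λ {k} → shape k)
            where
            shape : ∀ k → k + suc r ≤ n′ → headWord c e (k + suc r) ≡ a (k₀ + k)
            shape k le = begin
              headWord c e (k + suc r)            ≡⟨ cong (headWord c e) (+-suc k r) ⟩
              prepend e M (const zero) (k + r)    ≡⟨ prepend-≥ {r = e} (≤-trans e≤r (m≤n+m r k)) ⟩
              zero                                ≡⟨ sym (isZero k<j) ⟩
              a (k₀ + k)                          ∎
              where
              open ≡-Reasoning
              k<j : k < j
              k<j = +-cancelʳ-≤ r (suc k) j (subst₂ _≤_ (+-suc k r) (sym j+r≡n′) le)
          ... | t , t+r≤k₀ , occ =
            t , ≤-trans (m+n≤o⇒m≤o t t+r≤k₀) (≤-trans k₀≤K K≤i) , occ

        -- The window of b at l is headWord (b l) e.  Unless b l is maximal, that word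
        -- also occurs in the part of a which b shares.
        maximalAt : ∀ {e l} → e + l ≡ n′ → j ≤ l → (∀ {x} → l < x → x ≤ n′ → b x ≡ M) → b l ≡ M
        maximalAt {e} {l} e+l≡n′ j≤l above =
          decidable-stable (b l Fin.≟ M) λ b≢M → impossible b≢M (headWordEarly (b l) e≤r)
          where
          e≤r : e ≤ r
          e≤r = +-cancelˡ-≤ j e r (subst₂ _≤_ (+-comm e j) (trans e+l≡n′ (sym j+r≡n′)) (+-monoʳ-≤ e j≤l))
          l≤n′ : l ≤ n′
          l≤n′ = m+n≤o⇒n≤o e (≤-reflexive e+l≡n′)
          window : ∀ {k} → k ≤ n′ → b (l + k) ≡ headWord (b l) e k
          window {zero} _ = cong b (+-identityʳ l)
          window {suc k} k<n′ with k <? e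
          ... | yes k<e = trans (above (m<m+n l z<s) l+k<n′) (sym (prepend-< {r = e} k<e))
            where
            l+k<n′ : l + suc k ≤ n′
            l+k<n′ = subst (l + suc k ≤_) (trans (+-comm l e) e+l≡n′) (+-monoʳ-≤ l k<e)
          ... | no k≮e = begin
            b (l + suc k)              ≡⟨ agree n′<y (beforeI l≤i k<n′) ⟩
            a (l + suc k)              ≡⟨ cong a arith ⟩
            a (suc (k ∸ e) + n′)       ≡⟨ zeros (k ∸ e) x≤n′ (<-trans (≤-<-trans x≤n′ n′<i) i<N) ⟩
            zero                       ≡⟨ sym (prepend-≥ {r = e} e≤k) ⟩
            prepend e M (const zero) k ∎
            where
            open ≡-Reasoning
            e≤k = ≮⇒≥ k≮e
            l≤i = ≤-trans l≤n′ (<⇒≤ n′<i)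
            x≤n′ = ≤-trans (m∸n≤m k e) (<⇒≤ k<n′)
            arith : l + suc k ≡ suc (k ∸ e) + n′
            arith = begin
              l + suc k                ≡⟨ cong (λ k → l + suc k) (sym (m∸n+n≡m e≤k)) ⟩
              l + suc (k ∸ e + e)      ≡⟨ +-comm l _ ⟩
              suc (k ∸ e + e) + l      ≡⟨ +-assoc (suc (k ∸ e)) e l ⟩
              suc (k ∸ e) + (e + l)    ≡⟨ cong (suc (k ∸ e) +_) e+l≡n′ ⟩
              suc (k ∸ e) + n′         ∎
            n′<y : n′ < l + suc k
            n′<y = subst (n′ <_) (sym arith) (m<n+m n′ z<s)
          impossible : b l ≢ M → ¬ (∃[ t ] t ≤ i × OccursAt (headWord (b l) e) t)
          impossible b≢M (t , t≤i , occ) =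
            distinct (≤-trans 1≤j j≤l) (≤-<-trans l≤n′ n′<t) (≤-trans t≤i (<⇒≤ i<N)) λ {k} k≤n′ →
              trans (window k≤n′) (trans (sym (occ k≤n′))
                (sym (agree (≤-trans n′<t (m≤m+n t k)) (beforeI t≤i k≤n′))))
            where
            n′<t : n′ < t
            n′<t = ≰⇒> λ t≤n′ → b≢M (trans (sym (occ z≤n)) (trans (cong a (+-identityʳ t)) (start t≤n′)))

        -- Downward induction on `l` from `n′`, measured by `e`: `maximalAt` needs all digits above
        -- `l` first.
        maximalAbove : ∀ e {l} → e + l ≡ n′ → j ≤ l → ∀ {x} → l ≤ x → x ≤ n′ → b x ≡ M
        maximalAbove e {l} e+l≡n′ j≤l {x} l≤x x≤n′ with m≤n⇒m<n∨m≡n l≤x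
        maximalAbove zero    refl _   _ x≤n′ | inj₁ l<x = contradiction x≤n′ (<⇒≱ l<x)
        maximalAbove (suc e) {l} eq j≤l _ x≤n′ | inj₁ l<x =
          maximalAbove e (trans (+-suc e l) eq) (≤-trans j≤l (n≤1+n l)) l<x x≤n′
        maximalAbove zero    refl j≤l _ x≤n′ | inj₂ refl =
          maximalAt {0} refl j≤l λ l<x x≤n′ → contradiction x≤n′ (<⇒≱ l<x)
        maximalAbove (suc e) {l} eq j≤l _ x≤n′ | inj₂ refl =
          maximalAt {suc e} eq j≤l
            (maximalAbove e (trans (+-suc e l) eq) (≤-trans j≤l (n≤1+n l)))

        notRepeated : ¬ (∀ {k} → k ≤ n′ → b (j + k) ≡ b (suc i + k))
        notRepeated = distinct 1≤j (s≤s j≤i) i<N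

        -- Up to `n′` the digits of `b` from `j` on are maximal like those of `a`, and after that
        -- they are shared, so `b` has at `j` the window of `a`.
        repeated : ∀ {k} → k ≤ n′ → b (j + k) ≡ b (suc i + k)
        repeated {k} k≤n′ with j + k ≤? n′
        ... | yes j+k≤n′ = trans (maximalAbove r (trans (+-comm r j) j+r≡n′) ≤-refl (m≤m+n j k) j+k≤n′)
                             (trans (sym (start j+k≤n′)) (same k≤n′))
        ... | no  j+k≰n′ = trans (agree (≰⇒> j+k≰n′) (beforeI j≤i k≤n′)) (same k≤n′)

    notSmaller : ¬ (b (suc i + n′) Fin.< a (suc i + n′))
    notSmaller smaller = notRepeated repeated where open Smaller smaller

-- The positions in order of remoteness as windows of one cyclic sequence.

module Enumeration
  (m′ n′ : ℕ)
  (p : Fin (suc m′ ^ suc n′) → WardenGame.Position m′ n′)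
  (remoteness : WardenGame.EnumeratesByRemoteness m′ n′ p)
  where

  open WardenGame m′ n′
  open WardenGameProperties m′ n′

  N : ℕ
  N = m ^ n

  instance
    N≢0 : NonZero N
    N≢0 = m^n≢0 m n

  p-injective : Injective _≡_ _≡_ p
  p-injective {i} {j} pi≡pj = Fin.toℕ-injective 
    (suc-injective (≤-antisym (≤-from i j pi≡pj) (≤-from j i (sym pi≡pj))))
    where
    ≤-from : ∀ i j → p i ≡ p j → suc (toℕ i) ≤ suc (toℕ j)
    ≤-from i j eq = let _ , _ , least = remoteness i ; _ , force , _ = remoteness j in
      least (suc (toℕ j)) (s≤s z≤n) (subst (CanForceGoalWithin _) (sym eq) force)

  encode : Position → Fin N
  encode β = funToFin (lookup β)

  encode-injective : Injective _≡_ _≡_ encode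
  encode-injective {β} {γ} eq = lookup-ext λ k →
    trans (sym (Fin.finToFun-funToFin (lookup β) k))
      (trans (cong (λ x → finToFun {m} {n} x k) eq) (Fin.finToFun-funToFin (lookup γ) k))

  -- There are exactly `N` positions, so injectivity suffices.
  p-surjective : ∀ β → ∃[ i ] p i ≡ β
  p-surjective β =
    let i , eq = injective⇒surjective (p-injective ∘ encode-injective) (encode β)
    in i , encode-injective eq

  at : ℕ → Position
  at t = p (t mod N)

  at-% : ∀ {t t′} → t % N ≡ t′ % N → at t ≡ at t′
  at-% eq = cong p (mod-cong N eq)

  at-remoteness : ∀ {t} → t < N → IsRemoteness (at t) (suc t)
  at-remoteness {t} t<N =
    subst (λ k → IsRemoteness (at t) (suc k)) (trans (toℕ-mod N t) (m<n⇒m%n≡m t<N)) (remoteness (t mod N))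

  at-force : ∀ {t} → t < N → CanForceGoalWithin (suc t) (at t)
  at-force t<N = proj₁ (proj₂ (at-remoteness t<N))

  at-surjective : ∀ β → ∃[ t ] t < N × at t ≡ β
  at-surjective β = let i , pi≡β = p-surjective β in
    toℕ i , Fin.toℕ<n i , trans (cong p (toℕ[i]mod≡i N i)) pi≡β

  force⇒at : ∀ {k β} → CanForceGoalWithin k β → ∃[ t ] t < N × t < k × at t ≡ β
  force⇒at {zero} force = contradiction force ¬forceWithin0
  force⇒at {suc k} {β} force with at-surjective β
  ... | t , t<N , refl = t , t<N , proj₂ (proj₂ (at-remoteness t<N)) (suc k) (s≤s z≤n) force , refl

  at-favourable : ∀ {t} → t < N → Favourable t (at t)
  at-favourable t<N = force⇒favourable (at-force t<N)

  ¬favourableEarlier : ∀ {k} → suc k < N → ¬ Favourable k (at (suc k))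
  ¬favourableEarlier {k} k+1<N favourable =
    1+n≰n (proj₂ (proj₂ (at-remoteness k+1<N)) (suc k) (s≤s z≤n) (favourable⇒force favourable))

  -- Only `at k` has remoteness `suc k`, so for any other position the bound drops by one.
  withoutLatest : ∀ {k γ} → (γ ≡ at k → γ ≡ goal) → AtGoalOrForces (suc k) γ → AtGoalOrForces k γ
  withoutLatest _ (inj₁ γ≡goal) = inj₁ γ≡goal
  withoutLatest atK (inj₂ force) with force⇒at force
  ... | t , t<N , s≤s t≤k , refl with m≤n⇒m<n∨m≡n t≤k
  ... | inj₁ t<k  = inj₂ (force-mono t<k (at-force t<N))
  ... | inj₂ refl = inj₁ (atK refl)

  -- If another position came directly after the goal, arriving at the goal would count as won at
  -- once, and that position would be won one move sooner.
  goalLast : at (pred N) ≡ goal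
  goalLast with at-surjective goal
  ... | t , t<N , at≡goal with m≤n⇒m<n∨m≡n t<N
  ... | inj₂ eq = trans (cong (at ∘ pred) (sym eq)) at≡goal
  ... | inj₁ t+1<N = contradiction
    (favourable-map (λ _ → withoutLatest λ γ≡at → trans γ≡at at≡goal) (at-favourable t+1<N))
    (¬favourableEarlier t+1<N)

  -- Q t is the position of remoteness t for 1 ≤ t ≤ N, and Q 0 = goal.
  Q : ℕ → Position
  Q t = at (t + pred N)

  Q-suc : ∀ t → Q (suc t) ≡ at t
  Q-suc t = at-% (begin
    (suc t + pred N) % N  ≡⟨ cong (_% N) (sym (+-suc t (pred N))) ⟩
    (t + suc (pred N)) % N  ≡⟨ cong (λ z → (t + z) % N) (suc-pred N) ⟩
    (t + N) % N  ≡⟨ [m+n]%n≡m%n t N ⟩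
    t % N ∎)
    where open ≡-Reasoning

  Q-% : ∀ {t t′} → t % N ≡ t′ % N → Q t ≡ Q t′
  Q-% {t} {t′} eq = at-% (trans (sym (%-remainderˡ N t (pred N)))
    (trans (cong (λ z → (z + pred N) % N) eq) (%-remainderˡ N t′ (pred N))))

  -- If no move led to the position just before, the bound on every successor could be lowered,
  -- contradicting the remoteness.
  follows : ∀ t → t < N → ∃[ c ] Q t ≡ transfer c (at t)
  follows zero 0<N with at-favourable 0<N
  ... | (c , _ , inj₁ isGoal) , _ = c , trans goalLast (sym isGoal)
  ... | (_ , _ , inj₂ force)  , _ = contradiction force ¬forceWithin0
  follows (suc t) t<N with Fin.any? (λ c → transfer c (at (suc t)) ≟ₚ at t)
  ... | yes (c , eq) = c , trans (Q-suc t) (sym eq)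
  ... | no  none = contradiction
    (favourable-map (λ c → withoutLatest λ eq → contradiction (c , eq) none) (at-favourable t<N))
    (¬favourableEarlier t<N)

  Q-follows : ∀ t → ∃[ c ] Q t ≡ transfer c (Q (suc t))
  Q-follows t with follows (t % N) (m%n<n t N)
  ... | c , eq = c , trans (Q-% (sym (m%n%n≡m%n t N)))
    (trans eq (cong (transfer c) (trans (at-% (m%n%n≡m%n t N)) (sym (Q-suc t)))))

  a : ℕ → Fin m
  a t = head (Q t)

  head≡digit0 : ∀ {l} (xs : Vec (Fin m) (suc l)) → head xs ≡ digit xs 0
  head≡digit0 (x ∷ xs) = refl

  -- By the overlap, digit `suc k` of `Q t` is digit `k` of `Q (suc t)`.
  window : ∀ t {k} → k ≤ n′ → a (t + k) ≡ digit (Q t) k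
  window t {zero} _ = trans (cong a (+-identityʳ t)) (head≡digit0 (Q t))
  window t {suc k} k<n′ = begin
    a (t + suc k)                              ≡⟨ cong a (+-suc t k) ⟩
    a (suc t + k)                              ≡⟨ window (suc t) (<⇒≤ k<n′) ⟩
    digit (Q (suc t)) k                        ≡⟨ sym (digit-init c (Q (suc t)) k<n′) ⟩
    digit (transfer c (Q (suc t))) (suc k)     ≡⟨ cong (λ β → digit β (suc k)) (sym eq) ⟩
    digit (Q t) (suc k)                        ∎
    where
    open ≡-Reasoning
    c = proj₁ (Q-follows t)
    eq = proj₂ (Q-follows t)

  window-at : ∀ t {k} → k ≤ n′ → a (suc t + k) ≡ digit (at t) k
  window-at t {k} k≤n′ = trans (window (suc t) k≤n′) (cong (λ β → digit β k) (Q-suc t))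

  -- The game tree sequence is thus `a` read from index n on.
  a-last : ∀ t → a (suc t + n′) ≡ last (at t)
  a-last t = trans (window-at t ≤-refl) (digit-last (at t))

  start : ∀ {k} → k ≤ n′ → a k ≡ fromℕ m′
  start {k} k≤n′ = trans (window 0 k≤n′)
    (trans (cong (λ β → digit β k) goalLast) (digit-replicate n′ (fromℕ m′) k))

  -- Lowering the last digit to `b` keeps the successors, leaves the warden fewer choices, and lets
  -- the prisoner answer `b`, which was already good as a choice of the warden.
  greedy : ∀ {t b} → t < N → b Fin.< a (suc t + n′) →
    ∃[ t′ ] 1 ≤ t′ × t′ ≤ t ×
      (∀ {k} → k < n′ → a (t′ + k) ≡ a (suc t + k)) × a (t′ + n′) ≡ b
  greedy {t} {b} t<N b<a = earlier (force⇒at (favourable⇒force favourable))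
    where
    β β′ : Position
    β  = at t
    β′ = init β ∷ʳ b
    b<last : b Fin.< last β
    b<last = subst (b Fin.<_) (a-last t) b<a
    transfer≡ : ∀ c → transfer c β ≡ transfer c β′
    transfer≡ c = cong (c ∷_) (sym (init-∷ʳ b (init β)))
    good : ∀ c → c Fin.< last β → AtGoalOrForces t (transfer c β′)
    good c c<last = subst (AtGoalOrForces t) (transfer≡ c) (proj₂ (at-favourable t<N) c c<last)
    favourable : Favourable t β′
    favourable =
      (b , ≤-reflexive (cong toℕ (last-∷ʳ b (init β))) , good b b<last) ,
      λ c c<last → good c (<-trans (subst (c Fin.<_) (last-∷ʳ b (init β)) c<last) b<last)
    earlier : ∃[ t₁ ] t₁ < N × t₁ < suc t × at t₁ ≡ β′ →
      ∃[ t′ ] 1 ≤ t′ × t′ ≤ t ×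
        (∀ {k} → k < n′ → a (t′ + k) ≡ a (suc t + k)) × a (t′ + n′) ≡ b
    earlier (t₁ , t₁<N , s≤s t₁≤t , eq) =
      suc t₁ , s≤s z≤n , ≤∧≢⇒< t₁≤t differs ,
      (λ {k} k<n′ → begin
        a (suc t₁ + k)     ≡⟨ window-at t₁ (<⇒≤ k<n′) ⟩
        digit (at t₁) k    ≡⟨ cong (λ γ → digit γ k) eq ⟩
        digit β′ k         ≡⟨ digit-∷ʳ β b k<n′ ⟩
        digit β k          ≡⟨ sym (window-at t (<⇒≤ k<n′)) ⟩
        a (suc t + k)      ∎) ,
      trans (a-last t₁) last≡b
      where
      open ≡-Reasoning
      last≡b : last (at t₁) ≡ b
      last≡b = trans (cong last eq) (last-∷ʳ b (init β))
      differs : t₁ ≢ t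
      differs refl = <⇒≢ b<last (cong toℕ (sym last≡b))

  maximal : ∀ {t} c → t < N → a (suc t + n′) ≡ fromℕ m′ →
    ∃[ t′ ] t′ ≤ t × a t′ ≡ c × (∀ {k} → k < n′ → a (t′ + suc k) ≡ a (suc t + k))
  maximal {t} c t<N isMax = occurrence good
    where
    β : Position
    β = at t
    last≡M : last β ≡ fromℕ m′
    last≡M = trans (sym (a-last t)) isMax
    ≤M : ∀ (d : Fin m) → d Fin.≤ last β
    ≤M d = subst (d Fin.≤_) (sym last≡M) (Fin.≤fromℕ d)
    good : AtGoalOrForces t (transfer c β)
    good with at-favourable t<N | m≤n⇒m<n∨m≡n (≤M c)
    ... | _ , below                 | inj₁ c<last = below c c<last
    ... | (d , last≤d , good-d) , _ | inj₂ c≡last =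
      subst (λ d → AtGoalOrForces t (transfer d β))
        (Fin.toℕ-injective (trans (≤-antisym (≤M d) last≤d) (sym c≡last))) good-d
    occurrenceAt : ∀ {t′} → t′ ≤ t → Q t′ ≡ transfer c β →
      ∃[ t′ ] t′ ≤ t × a t′ ≡ c × (∀ {k} → k < n′ → a (t′ + suc k) ≡ a (suc t + k))
    occurrenceAt {t′} t′≤t eq = t′ , t′≤t , cong head eq , λ {k} k<n′ →
      trans (window t′ k<n′) (trans (cong (λ γ → digit γ (suc k)) eq)
        (trans (digit-init c β k<n′) (sym (window-at t (<⇒≤ k<n′)))))
    occurrence : AtGoalOrForces t (transfer c β) →
      ∃[ t′ ] t′ ≤ t × a t′ ≡ c × (∀ {k} → k < n′ → a (t′ + suc k) ≡ a (suc t + k))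
    occurrence (inj₁ isGoal) = occurrenceAt z≤n (trans goalLast (sym isGoal))
    occurrence (inj₂ force) with force⇒at force
    ... | t₁ , _ , t₁<t , eq = occurrenceAt t₁<t (trans (Q-suc t₁) eq)

  -- The de Bruijn property.

  lookup-cyclicBlock : ∀ (v : Vec (Fin m) N) i k →
    lookup (cyclicBlock {m} {n} v i) k ≡ lookup v ((toℕ i + toℕ k) mod N)
  lookup-cyclicBlock v i k = lookup∘tabulate (λ k → lookup v ((toℕ i + toℕ k) mod N)) k

  s : Vec (Fin m) N
  s = gameTreeSequence p

  lookup-s : ∀ t → lookup s (t mod N) ≡ a (suc t + n′)
  lookup-s t = trans (lookup∘tabulate (last ∘ p) (t mod N)) (sym (a-last t))

  block-s : ∀ i → cyclicBlock {m} {n} s i ≡ at (toℕ i + n′)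
  block-s i = lookup-ext λ k → begin
    lookup (cyclicBlock {m} {n} s i) k       ≡⟨ lookup-cyclicBlock s i k ⟩
    lookup s ((toℕ i + toℕ k) mod N)         ≡⟨ lookup-s (toℕ i + toℕ k) ⟩
    a (suc (toℕ i + toℕ k) + n′)             ≡⟨ cong (a ∘ suc)
                                                  (xy∙z≈xz∙y +-commutativeSemigroup (toℕ i) (toℕ k) n′) ⟩
    a (suc (toℕ i + n′) + toℕ k)             ≡⟨ window-at (toℕ i + n′) (s≤s⁻¹ (Fin.toℕ<n k)) ⟩
    digit (at (toℕ i + n′)) (toℕ k)          ≡⟨ sym (lookup-digit (at (toℕ i + n′)) k) ⟩
    lookup (at (toℕ i + n′)) k               ∎
    where open ≡-Reasoning

  isDeBruijn : IsDeBruijn {m} {n} s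
  isDeBruijn w with at-surjective w
  ... | g , g<N , refl = i , trans (block-s i) (at-% i≡) , unique
    where
    -- The index `g - n′` modulo `N`, as the block at `i` is the position at `i + n′`.
    i : Fin N
    i = (g + n′ * pred N) mod N
    i≡ : (toℕ i + n′) % N ≡ g % N
    i≡ = begin
      (toℕ i + n′) % N                      ≡⟨ cong (λ z → (z + n′) % N) (toℕ-mod N _) ⟩
      ((g + n′ * pred N) % N + n′) % N      ≡⟨ %-remainderˡ N _ n′ ⟩
      (g + n′ * pred N + n′) % N            ≡⟨ cong (_% N) (xy∙z≈xz∙y +-commutativeSemigroup g _ n′) ⟩
      (g + n′ + n′ * pred N) % N            ≡⟨ %-complement N g n′ ⟩
      g % N                                 ∎
      where open ≡-Reasoning
    unique : ∀ {i′} → cyclicBlock {m} {n} s i′ ≡ at g → i ≡ i′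
    unique {i′} eq = begin
      i               ≡⟨ sym (toℕ[i]mod≡i N i) ⟩
      toℕ i mod N     ≡⟨ mod-cong N (%-cancelʳ-+ N n′ (trans i≡ g≡)) ⟩
      toℕ i′ mod N    ≡⟨ toℕ[i]mod≡i N i′ ⟩
      i′              ∎
      where
      open ≡-Reasoning
      g≡ : g % N ≡ (toℕ i′ + n′) % N
      g≡ = mod-injective N (p-injective (trans (sym eq) (block-s i′)))

  -- Lexicographic minimality.

  module Rival (s′ : Vec (Fin m) N) (s′-deBruijn : IsDeBruijn {m} {n} s′) where

    -- Congruent to - n modulo N.
    offset : ℕ
    offset = n * pred N

    -- Aligned with `a`: `s′` starts at index n, and the indices up to `n′` hold the digits that
    -- cyclically precede it.
    b : ℕ → Fin m
    b t = lookup s′ ((t + offset) mod N)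

    b-lookup : ∀ x → b (suc x + n′) ≡ lookup s′ (x mod N)
    b-lookup x = cong (lookup s′) (mod-cong N
      (trans (cong (λ z → (z + offset) % N) (sym (+-suc x n′))) (%-complement N x n)))

    block-b : ∀ t k → lookup (cyclicBlock {m} {n} s′ ((t + offset) mod N)) k ≡ b (t + toℕ k)
    block-b t k = trans (lookup-cyclicBlock s′ _ k) (cong (lookup s′) (mod-cong N (begin
      (toℕ ((t + offset) mod N) + toℕ k) % N   ≡⟨ cong (λ z → (z + toℕ k) % N) (toℕ-mod N _) ⟩
      ((t + offset) % N + toℕ k) % N           ≡⟨ %-remainderˡ N _ _ ⟩
      (t + offset + toℕ k) % N                 ≡⟨ cong (_% N) (xy∙z≈xz∙y +-commutativeSemigroup t offset _) ⟩
      (t + toℕ k + offset) % N                 ∎)))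
      where open ≡-Reasoning

    distinct : ∀ {t t′} → 1 ≤ t → t < t′ → t′ ≤ N → ¬ (∀ {k} → k ≤ n′ → b (t + k) ≡ b (t′ + k))
    distinct {t} {t′} 1≤t t<t′ t′≤N same =
      %-distinct N 1≤t t<t′ t′≤N (%-cancelʳ-+ N offset (mod-injective N
        (trans (sym (unique refl)) (unique (sym blocks≡)))))
      where
      blocks≡ : cyclicBlock {m} {n} s′ ((t + offset) mod N) ≡
                cyclicBlock {m} {n} s′ ((t′ + offset) mod N)
      blocks≡ = lookup-ext λ k →
        trans (block-b t k) (trans (same (s≤s⁻¹ (Fin.toℕ<n k))) (sym (block-b t′ k)))
      unique = λ {i} → proj₂ (proj₂ (s′-deBruijn (cyclicBlock {m} {n} s′ ((t + offset) mod N)))) {i}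

    notSmallerAt : ∀ i → (∀ j → j Fin.< i → lookup s j ≡ lookup s′ j) →
                   ¬ (lookup s′ i Fin.< lookup s i)
    notSmallerAt i same smaller = notSmaller b (Fin.toℕ<n i) agree distinct smaller′
      where
      at-i : ∀ (v : Vec (Fin m) N) → lookup v (toℕ i mod N) ≡ lookup v i
      at-i v = cong (lookup v) (toℕ[i]mod≡i N i)
      smaller′ : b (suc (toℕ i) + n′) Fin.< a (suc (toℕ i) + n′)
      smaller′ = subst₂ Fin._<_
        (sym (trans (b-lookup (toℕ i)) (at-i s′)))
        (trans (sym (at-i s)) (lookup-s (toℕ i)))
        smaller
      -- With a single digit, m = 1, none could be smaller than another.
      max≢0 : fromℕ m′ ≢ zero
      max≢0 M≡0 = contradiction (≤-trans smaller (subst (lookup s i Fin.≤_) M≡0 (Fin.≤fromℕ _))) λ ()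
      open MaxFirst m′ n′ N a start greedy maximal max≢0
      agree : ∀ {y} → n′ < y → y < suc (toℕ i) + n′ → b y ≡ a y
      agree {y} n′<y y<i+n = begin
        b y                  ≡⟨ cong b y≡ ⟩
        b (suc x + n′)       ≡⟨ b-lookup x ⟩
        lookup s′ (x mod N)  ≡⟨ sym (same (x mod N) (subst (_< toℕ i) (sym x≡) x<i)) ⟩
        lookup s (x mod N)   ≡⟨ lookup-s x ⟩
        a (suc x + n′)       ≡⟨ cong a (sym y≡) ⟩
        a y                  ∎
        where
        open ≡-Reasoning
        x = y ∸ suc n′
        y≡ : y ≡ suc x + n′
        y≡ = trans (sym (m∸n+n≡m n′<y)) (+-suc x n′)
        x<i : x < toℕ i
        x<i = +-cancelʳ-< n′ x (toℕ i) (s≤s⁻¹ (subst (_< suc (toℕ i) + n′) y≡ y<i+n))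
        x≡ : toℕ (x mod N) ≡ x
        x≡ = trans (toℕ-mod N x) (m<n⇒m%n≡m (<-trans x<i (Fin.toℕ<n i)))

    s≤s′ : Lex-≤ _≡_ Fin._<_ s s′
    s≤s′ = ≤-lexicographic s s′ notSmallerAt

theorem5 : ∀ (m′ n′ : ℕ) → let open WardenGame m′ n′ in
    ∀ (p : Fin (m ^ n) → Position) → EnumeratesByRemoteness p →
    IsLexMinimalDeBruijn {m} {n} (gameTreeSequence p)
theorem5 m′ n′ p remoteness = isDeBruijn , Rival.s≤s′
  where open Enumeration m′ n′ p remoteness
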